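{- For every permutation graph $G$, $\operatorname{box}(G)\le 2\Delta(G)+1$, where $\Delta(G)$ is the maximum degree of $G$.
   Context: For a permutation $\pi$ of $\{1,\dots,n\}$, the graph $G[\pi]$ has vertex set $\{1,\dots,n\}$ and an edge $ij$ iff $(i-j)(\pi^{ -1}(i)-\pi^{ -1}(j))<0$. A graph is a permutation graph if it is isomorphic to $G[\pi]$ for some permutation $\pi$. The boxicity $\operatorname{box}(G)$ is the minimum $b$ such that $G$ is the intersection graph of axis-parallel boxes in $\mathbb{R}^b$ (products of $b$ closed intervals), one box per vertex. -}

module Defs where

open import Data.Empty using (⊥-elim)
open import Data.Fin using (Fin; zero; suc; toℕ; fromℕ<)
open import Data.Fin.Permutation using (Permutation; Permutation′; _⟨$⟩ʳ_; _⟨$⟩ˡ_)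
open import Data.Fin.Properties using (any?; all?; toℕ-fromℕ<) renaming (_≟_ to _≟ᶠ_)
open import Data.Fin.Subset using (Subset; _∈_; ∣_∣)
open import Data.Fin.Subset.Properties using (∣p∣≤n; p⊆q⇒∣p∣≤∣q∣; p⊂q⇒∣p∣<∣q∣)
open import Data.Integer as ℤ using (ℤ; +_; 0ℤ)
import Data.Integer.Properties as ℤₚ
import Data.Integer.Tactic.RingSolver as ℤ-Solver
open import Data.List using (length; filter; map; allFin)
open import Data.List.Extrema.Nat using (max)
open import Data.Nat using (ℕ; zero; suc; _≤_; _≤?_; _⊔_; z≤n; s≤s)
import Data.Nat.Coprimality as Coprimality
import Data.Nat.Properties as ℕₚ
open import Data.Product using (Σ; ∃; ∃-syntax; _×_; _,_; proj₁; proj₂)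
open import Data.Rational as ℚ using (ℚ)
import Data.Rational.Properties as ℚₚ
open import Data.Sum using (_⊎_; inj₁; inj₂)
open import Data.Vec using (Vec; []; _∷_; lookup; tabulate)
open import Data.Vec.Properties using (lookup∘tabulate; lookup⇒[]=; []=⇒lookup)
open import Function using (_∘_; id)
open import Function.Bundles using (_⇔_; mk⇔; module Equivalence)
open import Relation.Binary using (Decidable; tri<; tri≈; tri>)
open import Relation.Binary.PropositionalEquality using (_≡_; _≢_; refl; sym; trans; cong; subst; subst₂)
open import Relation.Nullary using (¬_; Dec; yes; no; does)
open import Relation.Nullary.Decidable using (map′; _×-dec_; _→-dec_; ¬?; decidable-stable; dec-true; toWitness; ¬¬-excluded-middle)

open Equivalence using (to; from)

record Graph : Set₁ where
  field
    order  : ℕ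
    Adj    : Fin order → Fin order → Set
    adj?   : Decidable Adj
    symm   : ∀ {u v} → Adj u v → Adj v u
    irrefl : ∀ {v} → ¬ Adj v v

  Vertex : Set
  Vertex = Fin order

  degree : Vertex → ℕ
  degree v = length (filter (adj? v) (allFin order))

open Graph using (Vertex)

-- The maximum degree of the graph without vertices is 0.
Δ : Graph → ℕ
Δ G = max 0 (map (Graph.degree G) (allFin (Graph.order G)))

_≅_ : Graph → Graph → Set
G ≅ H = Σ (Permutation (Graph.order G) (Graph.order H)) λ σ →
  ∀ u v → Graph.Adj G u v ⇔ Graph.Adj H (σ ⟨$⟩ʳ u) (σ ⟨$⟩ʳ v)

-- Vertices are 0, …, n-1 instead of 1, …, n; only differences of labels matter.
-- _⟨$⟩ˡ_ applies the inverse permutation.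
G[_] : ∀ {n} → Permutation′ n → Graph
G[_] {n} π = record
  { order  = n
  ; Adj    = λ i j → inv i j ℤ.< 0ℤ
  ; adj?   = λ i j → inv i j ℤ.<? 0ℤ
  ; symm   = λ {i} {j} → subst (ℤ._< 0ℤ) (inv-comm (pos i) (pos j) (pos (π ⟨$⟩ˡ i)) (pos (π ⟨$⟩ˡ j)))
  ; irrefl = λ {i} p → ℤₚ.<-irrefl (inv-refl i) p
  }
  where
  pos : Fin n → ℤ
  pos i = + toℕ i

  inv : Fin n → Fin n → ℤ
  inv i j = (pos i ℤ.- pos j) ℤ.* (pos (π ⟨$⟩ˡ i) ℤ.- pos (π ⟨$⟩ˡ j))

  inv-comm : ∀ a b c d → (a ℤ.- b) ℤ.* (c ℤ.- d) ≡ (b ℤ.- a) ℤ.* (d ℤ.- c)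
  inv-comm = ℤ-Solver.solve-∀

  inv-refl : ∀ i → inv i i ≡ 0ℤ
  inv-refl i = cong (ℤ._* (pos (π ⟨$⟩ˡ i) ℤ.- pos (π ⟨$⟩ˡ i))) (ℤₚ.+-inverseʳ (pos i))

IsPermutationGraph : Graph → Set
IsPermutationGraph G = ∃[ n ] Σ (Permutation′ n) λ π → G ≅ G[ π ]

-- Dedekind reals: two-sided, rounded, located cuts of ℚ.
record ℝ : Set₁ where
  field
    L U         : ℚ → Set
    L-inhabited : ∃[ q ] L q
    U-inhabited : ∃[ q ] U q
    L-rounded   : ∀ q → L q ⇔ (∃[ r ] (q ℚ.< r × L r))
    U-rounded   : ∀ q → U q ⇔ (∃[ r ] (r ℚ.< q × U r))
    disjoint    : ∀ q → ¬ (L q × U q)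
    located     : ∀ q r → q ℚ.< r → L q ⊎ U r

open ℝ

infix 4 _≤ᴿ_
_≤ᴿ_ : ℝ → ℝ → Set
x ≤ᴿ y = ∀ q → L x q → L y q

record Interval : Set₁ where
  field
    lo hi : ℝ
    lo≤hi : lo ≤ᴿ hi

open Interval

_∈ᴵ_ : ℝ → Interval → Set
x ∈ᴵ I = lo I ≤ᴿ x × x ≤ᴿ hi I

Point : ℕ → Set₁
Point b = Fin b → ℝ

Box : ℕ → Set₁
Box b = Fin b → Interval

_∈ᴮ_ : ∀ {b} → Point b → Box b → Set
x ∈ᴮ B = ∀ i → x i ∈ᴵ B i

Intersect : ∀ {b} → Box b → Box b → Set₁
Intersect {b} B C = Σ (Point b) λ x → x ∈ᴮ B × x ∈ᴮ C

BoxRepresentation : Graph → ℕ → Set₁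
BoxRepresentation G b = Σ (Vertex G → Box b) λ B →
  ∀ u v → u ≢ v → Graph.Adj G u v ⇔ Intersect (B u) (B v)

IsBoxicity : Graph → ℕ → Set₁
IsBoxicity G b = BoxRepresentation G b × (∀ c → BoxRepresentation G c → b ≤ c)

-- Everything from here to `boxicity` serves to show that the minimum exists. A
-- constructive proof has to decide whether a graph has a box representation in
-- a given dimension; this is reduced to representations whose end points lie
-- in {0, …, n}, n the number of vertices, of which there are finitely many.

private

  ℚ-pred : ∀ q → q ℚ.- ℚ.1ℚ ℚ.< q
  ℚ-pred q = subst (q ℚ.- ℚ.1ℚ ℚ.<_) (ℚₚ.+-identityʳ q)
    (ℚₚ.+-monoʳ-< q (toWitness {a? = (ℚ.- ℚ.1ℚ) ℚ.<? ℚ.0ℚ} _))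

  ℚ-suc : ∀ q → q ℚ.< q ℚ.+ ℚ.1ℚ
  ℚ-suc q = subst (ℚ._< q ℚ.+ ℚ.1ℚ) (ℚₚ.+-identityʳ q)
    (ℚₚ.+-monoʳ-< q (toWitness {a? = ℚ.0ℚ ℚ.<? ℚ.1ℚ} _))

fromℚ : ℚ → ℝ
fromℚ p = record
  { L = ℚ._< p
  ; U = p ℚ.<_
  ; L-inhabited = p ℚ.- ℚ.1ℚ , ℚ-pred p
  ; U-inhabited = p ℚ.+ ℚ.1ℚ , ℚ-suc p
  ; L-rounded = λ q → mk⇔ ℚₚ.<-dense λ (r , q<r , r<p) → ℚₚ.<-trans q<r r<p
  ; U-rounded = λ q → mk⇔ (λ p<q → let r , p<r , r<q = ℚₚ.<-dense p<q in r , r<q , p<r)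
                          (λ (r , r<q , p<r) → ℚₚ.<-trans p<r r<q)
  ; disjoint = λ q (q<p , p<q) → ℚₚ.<-asym q<p p<q
  ; located = loc
  }
  where
  loc : ∀ q r → q ℚ.< r → q ℚ.< p ⊎ p ℚ.< r
  loc q r q<r with ℚₚ.<-cmp q p
  ... | tri< q<p _ _ = inj₁ q<p
  ... | tri≈ _ refl _ = inj₂ q<r
  ... | tri> _ _ p<q = inj₂ (ℚₚ.<-trans p<q q<r)

fromℕ : ℕ → ℝ
fromℕ n = fromℚ (ℚ.mkℚ (+ n) 0 (Coprimality.sym (Coprimality.1-coprimeTo n)))

≤ᴿ-refl : ∀ {x} → x ≤ᴿ x
≤ᴿ-refl q = id

≤ᴿ-trans : ∀ {x y z} → x ≤ᴿ y → y ≤ᴿ z → x ≤ᴿ z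
≤ᴿ-trans p r q = r q ∘ p q

abstract

  L-below-U : ∀ x {q r} → L x q → U x r → q ℚ.< r
  L-below-U x {q} {r} lq ur with ℚₚ.<-cmp q r
  ... | tri< q<r _ _ = q<r
  ... | tri≈ _ refl _ = ⊥-elim (disjoint x q (lq , ur))
  ... | tri> _ _ r<q = ⊥-elim (disjoint x r (from (L-rounded x r) (q , r<q , lq) , ur))

  ≰ᴿ⇒≥ᴿ : ∀ x y → ¬ (x ≤ᴿ y) → y ≤ᴿ x
  ≰ᴿ⇒≥ᴿ x y x≰y q lyq with to (L-rounded y q) lyq
  ... | r , q<r , lyr with located x q r q<r
  ...   | inj₁ lxq = lxq
  ...   | inj₂ uxr = ⊥-elim (x≰y λ s lxs → from (L-rounded y s) (r , L-below-U x lxs uxr , lyr))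

  fromℚ-mono : ∀ {p q} → p ℚ.≤ q → fromℚ p ≤ᴿ fromℚ q
  fromℚ-mono p≤q r r<p = ℚₚ.<-≤-trans r<p p≤q

  fromℚ-cancel : ∀ {p q} → fromℚ p ≤ᴿ fromℚ q → p ℚ.≤ q
  fromℚ-cancel {p} {q} h = ℚₚ.≮⇒≥ λ q<p → ℚₚ.<-irrefl refl (h q q<p)

  fromℕ-mono : ∀ {m n} → m ≤ n → fromℕ m ≤ᴿ fromℕ n
  fromℕ-mono {m} {n} m≤n = fromℚ-mono (ℚ.*≤* (ℤₚ.*-monoʳ-≤-nonNeg (+ 1) (ℤ.+≤+ m≤n)))

  fromℕ-cancel : ∀ {m n} → fromℕ m ≤ᴿ fromℕ n → m ≤ n
  fromℕ-cancel {m} {n} h = ℤ.drop‿+≤+ (ℤₚ.*-cancelʳ-≤-pos (+ m) (+ n) (+ 1) (ℚ.drop-*≤* (fromℚ-cancel h)))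

module _ (G : Graph) where

  open Graph G using (order; Adj; adj?; symm)

  record ℕ-Representation (b : ℕ) : Set where
    field
      l r  : Fin b → Fin order → ℕ
      l≤r  : ∀ i v → l i v ≤ r i v
      spec : ∀ u v → u ≢ v → Adj u v ⇔ (∀ i → l i u ≤ r i v × l i v ≤ r i u)

  abstract

    ℕ⇒Box : ∀ {b} → ℕ-Representation b → BoxRepresentation G b
    ℕ⇒Box {b} R = B , λ u v u≢v → mk⇔ (fwd u v ∘ to (spec u v u≢v)) (from (spec u v u≢v) ∘ bwd u v)
      where
      open ℕ-Representation R
      B : Fin order → Box b
      B v i = record { lo = fromℕ (l i v) ; hi = fromℕ (r i v) ; lo≤hi = fromℕ-mono (l≤r i v) }

      fwd : ∀ u v → (∀ i → l i u ≤ r i v × l i v ≤ r i u) → Intersect (B u) (B v)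
      fwd u v h = (λ i → fromℕ (l i u ⊔ l i v))
        , (λ i → fromℕ-mono (ℕₚ.m≤m⊔n _ _) , fromℕ-mono (ℕₚ.⊔-lub (l≤r i u) (proj₂ (h i))))
        , (λ i → fromℕ-mono (ℕₚ.m≤n⊔m (l i u) _) , fromℕ-mono (ℕₚ.⊔-lub (proj₁ (h i)) (l≤r i v)))

      bwd : ∀ u v → Intersect (B u) (B v) → ∀ i → l i u ≤ r i v × l i v ≤ r i u
      bwd u v (x , x∈u , x∈v) i =
          fromℕ-cancel (≤ᴿ-trans {fromℕ (l i u)} {x i} {fromℕ (r i v)} (proj₁ (x∈u i)) (proj₂ (x∈v i)))
        , fromℕ-cancel (≤ᴿ-trans {fromℕ (l i v)} {x i} {fromℕ (r i u)} (proj₁ (x∈v i)) (proj₂ (x∈u i)))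

    -- One coordinate per vertex w, separating w from its non-neighbours:
    -- w ↦ [0,0], neighbours of w ↦ [0,1], all other vertices ↦ [1,1].
    trivialRepresentation : ℕ-Representation order
    trivialRepresentation = record { l = l ; r = r ; l≤r = l≤r ; spec = λ u v u≢v → mk⇔ (fwd u≢v) (bwd u≢v) }
      where
      l r : Fin order → Fin order → ℕ
      l w v with w ≟ᶠ v | adj? w v
      ... | yes _ | _     = 0
      ... | no _  | yes _ = 0
      ... | no _  | no _  = 1
      r w v with w ≟ᶠ v
      ... | yes _ = 0
      ... | no _  = 1

      l≤1 : ∀ w v → l w v ≤ 1
      l≤1 w v with w ≟ᶠ v | adj? w v
      ... | yes _ | _     = z≤n
      ... | no _  | yes _ = z≤n
      ... | no _  | no _  = s≤s z≤n

      l≤r : ∀ w v → l w v ≤ r w v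
      l≤r w v with w ≟ᶠ v | adj? w v
      ... | yes _ | _     = z≤n
      ... | no _  | yes _ = z≤n
      ... | no _  | no _  = s≤s z≤n

      l-adj : ∀ {w v} → Adj w v → l w v ≤ 0
      l-adj {w} {v} a with w ≟ᶠ v | adj? w v
      ... | yes _ | _     = z≤n
      ... | no _  | yes _ = z≤n
      ... | no _  | no ¬a = ⊥-elim (¬a a)

      half : ∀ {u v} → Adj u v → ∀ w → l w u ≤ r w v
      half {u} {v} a w with w ≟ᶠ v
      ... | yes refl = l-adj (symm a)
      ... | no _     = l≤1 w u

      fwd : ∀ {u v} → u ≢ v → Adj u v → ∀ w → l w u ≤ r w v × l w v ≤ r w u
      fwd _ a w = half a w , half (symm a) w

      bwd : ∀ {u v} → u ≢ v → (∀ w → l w u ≤ r w v × l w v ≤ r w u) → Adj u v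
      bwd {u} {v} u≢v h with proj₂ (h u)
      ... | p with u ≟ᶠ u | u ≟ᶠ v | adj? u v
      ...   | _     | _       | yes a = a
      ...   | _     | yes u≡v | no _  = ⊥-elim (u≢v u≡v)
      ...   | no ¬e | no _    | no _  = ⊥-elim (¬e refl)
      bwd u≢v h | () | yes _ | no _ | no _

  private

    Code : ℕ → Set
    Code b = Vec (Vec (Fin (suc order) × Fin (suc order)) order) b

    codeL codeR : ∀ {b} → Code b → Fin b → Fin order → ℕ
    codeL c i v = toℕ (proj₁ (lookup (lookup c i) v))
    codeR c i v = toℕ (proj₂ (lookup (lookup c i) v))

    Valid : ∀ {b} → Code b → Set
    Valid c = (∀ i v → codeL c i v ≤ codeR c i v)
      × (∀ u v → u ≢ v →
           (Adj u v → ∀ i → codeL c i u ≤ codeR c i v × codeL c i v ≤ codeR c i u)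
         × ((∀ i → codeL c i u ≤ codeR c i v × codeL c i v ≤ codeR c i u) → Adj u v))

    valid? : ∀ {b} (c : Code b) → Dec (Valid c)
    valid? c = all? (λ i → all? λ v → codeL c i v ≤? codeR c i v)
      ×-dec all? (λ u → all? λ v → ¬? (u ≟ᶠ v) →-dec
        ((adj? u v →-dec meet? u v) ×-dec (meet? u v →-dec adj? u v)))
      where
      meet? = λ u v → all? λ i → (codeL c i u ≤? codeR c i v) ×-dec (codeL c i v ≤? codeR c i u)

    Searchable : Set → Set₁
    Searchable A = (P : A → Set) → (∀ a → Dec (P a)) → Dec (∃ P)

    searchFin : ∀ {n} → Searchable (Fin n)
    searchFin P P? = any? P?

    search× : ∀ {A B} → Searchable A → Searchable B → Searchable (A × B)
    search× sA sB P P? = map′ (λ (a , b , p) → (a , b) , p) (λ ((a , b) , p) → a , b , p)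
      (sA _ λ a → sB _ λ b → P? (a , b))

    searchVec : ∀ {A} n → Searchable A → Searchable (Vec A n)
    searchVec zero    s P P? = map′ (λ p → [] , p) (λ { ([] , p) → p }) (P? [])
    searchVec (suc n) s P P? = map′ (λ (a , v , p) → a ∷ v , p) (λ { (a ∷ v , p) → a , v , p })
      (s _ λ a → searchVec n s _ λ v → P? (a ∷ v))

    code? : ∀ b → Dec (∃ λ (c : Code b) → Valid c)
    code? b = searchVec b (searchVec order (search× searchFin searchFin)) Valid valid?

    Code⇒ℕ : ∀ {b} → (∃ λ (c : Code b) → Valid c) → ℕ-Representation b
    Code⇒ℕ (c , c≤ , c⇔) = record
      { l = codeL c ; r = codeR c ; l≤r = c≤
      ; spec = λ u v u≢v → mk⇔ (proj₁ (c⇔ u v u≢v)) (proj₂ (c⇔ u v u≢v)) }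

    ¬¬-all : ∀ {n} {P : Fin n → Set} → (∀ i → ¬ ¬ P i) → ¬ ¬ (∀ i → P i)
    ¬¬-all {zero}  h k = k λ ()
    ¬¬-all {suc n} h k = h zero λ p → ¬¬-all (h ∘ suc) λ ps → k λ { zero → p ; (suc i) → ps i }

    module FromBox {b : ℕ} (B : Fin order → Box b) (BSpec : ∀ u v → u ≢ v → Adj u v ⇔ Intersect (B u) (B v))
      (ll? : ∀ i w v → Dec (lo (B w i) ≤ᴿ lo (B v i)))
      (lh? : ∀ i w v → Dec (lo (B w i) ≤ᴿ hi (B v i))) where

      -- End points are replaced by the number of lower end points not exceeding them.
      below : {P : Fin order → Set} → (∀ w → Dec (P w)) → Subset order
      below P? = tabulate (does ∘ P?)

      ∈below⁺ : ∀ {P : Fin order → Set} (P? : ∀ w → Dec (P w)) {w} → P w → w ∈ below P?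
      ∈below⁺ P? {w} p = lookup⇒[]= w _ (trans (lookup∘tabulate _ w) (dec-true (P? w) p))

      ∈below⁻ : ∀ {P : Fin order → Set} (P? : ∀ w → Dec (P w)) {w} → w ∈ below P? → P w
      ∈below⁻ P? {w} m with P? w | trans (sym (lookup∘tabulate (does ∘ P?) w)) ([]=⇒lookup m)
      ... | yes p | _ = p
      ... | no _  | ()

      SL SR : Fin b → Fin order → Subset order
      SL i v = below (λ w → ll? i w v)
      SR i v = below (λ w → lh? i w v)

      rank : Subset order → Fin (suc order)
      rank S = fromℕ< (s≤s (∣p∣≤n S))

      c : Code b
      c = tabulate λ i → tabulate λ v → rank (SL i v) , rank (SR i v)

      c-lookup : ∀ i v → lookup (lookup c i) v ≡ (rank (SL i v) , rank (SR i v))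
      c-lookup i v = trans (cong (λ row → lookup row v) (lookup∘tabulate _ i)) (lookup∘tabulate _ v)

      codeL≡ : ∀ i v → codeL c i v ≡ ∣ SL i v ∣
      codeL≡ i v = trans (cong (toℕ ∘ proj₁) (c-lookup i v)) (toℕ-fromℕ< _)

      codeR≡ : ∀ i v → codeR c i v ≡ ∣ SR i v ∣
      codeR≡ i v = trans (cong (toℕ ∘ proj₂) (c-lookup i v)) (toℕ-fromℕ< _)

      mono : ∀ i u v → lo (B u i) ≤ᴿ hi (B v i) → codeL c i u ≤ codeR c i v
      mono i u v p = subst₂ _≤_ (sym (codeL≡ i u)) (sym (codeR≡ i v)) (p⊆q⇒∣p∣≤∣q∣ {p = SL i u} λ {w} m →
        ∈below⁺ (λ w → lh? i w v)
          (≤ᴿ-trans {lo (B w i)} {lo (B u i)} {hi (B v i)} (∈below⁻ (λ w → ll? i w u) m) p))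

      cancel : ∀ i u v → codeL c i u ≤ codeR c i v → lo (B u i) ≤ᴿ hi (B v i)
      cancel i u v h = decidable-stable (lh? i u v) λ ¬p →
        ℕₚ.<⇒≱ (p⊂q⇒∣p∣<∣q∣ {p = SR i v} {q = SL i u}
          ( (λ {w} m → ∈below⁺ (λ w → ll? i w u)
              (≤ᴿ-trans {lo (B w i)} {hi (B v i)} {lo (B u i)} (∈below⁻ (λ w → lh? i w v) m)
                (≰ᴿ⇒≥ᴿ (lo (B u i)) (hi (B v i)) ¬p)))
          , u
          , ∈below⁺ (λ w → ll? i w u) (≤ᴿ-refl {lo (B u i)})
          , (λ m → ¬p (∈below⁻ (λ w → lh? i w v) m)) ))
          (subst₂ _≤_ (codeL≡ i u) (codeR≡ i v) h)

      Meet : Fin order → Fin order → Set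
      Meet u v = ∀ i → codeL c i u ≤ codeR c i v × codeL c i v ≤ codeR c i u

      fwd : ∀ u v → Intersect (B u) (B v) → Meet u v
      fwd u v (x , x∈u , x∈v) i =
          mono i u v (≤ᴿ-trans {lo (B u i)} {x i} {hi (B v i)} (proj₁ (x∈u i)) (proj₂ (x∈v i)))
        , mono i v u (≤ᴿ-trans {lo (B v i)} {x i} {hi (B u i)} (proj₁ (x∈v i)) (proj₂ (x∈u i)))

      bwd : ∀ u v → Meet u v → Intersect (B u) (B v)
      bwd u v h = proj₁ ∘ pt , proj₁ ∘ proj₂ ∘ pt , proj₂ ∘ proj₂ ∘ pt
        where
        pt : ∀ i → Σ ℝ λ x → x ∈ᴵ B u i × x ∈ᴵ B v i
        pt i with ll? i u v
        ... | yes p = lo (B v i)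
                    , (p , cancel i v u (proj₂ (h i)))
                    , (≤ᴿ-refl {lo (B v i)} , lo≤hi (B v i))
        ... | no ¬p = lo (B u i)
                    , (≤ᴿ-refl {lo (B u i)} , lo≤hi (B u i))
                    , (≰ᴿ⇒≥ᴿ (lo (B u i)) (lo (B v i)) ¬p , cancel i u v (proj₁ (h i)))

      valid : Valid c
      valid = (λ i v → mono i v v (lo≤hi (B v i)))
            , λ u v u≢v → fwd u v ∘ to (BSpec u v u≢v) , from (BSpec u v u≢v) ∘ bwd u v

    Box⇒Code : ∀ {b} → BoxRepresentation G b → ∃ λ (c : Code b) → Valid c
    Box⇒Code {b} (B , BSpec) = decidable-stable (code? b) λ k →
      ¬¬-all (λ i → ¬¬-all λ w → ¬¬-all λ v → ¬¬-excluded-middle) λ ll? →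
      ¬¬-all (λ i → ¬¬-all λ w → ¬¬-all λ v → ¬¬-excluded-middle) λ lh? →
      k (FromBox.c B BSpec ll? lh? , FromBox.valid B BSpec ll? lh?)

  abstract

    boxRepresentation? : ∀ b → Dec (BoxRepresentation G b)
    boxRepresentation? b = map′ (ℕ⇒Box ∘ Code⇒ℕ) Box⇒Code (code? b)

    private
      least : ∀ {P : ℕ → Set₁} → (∀ n → Dec (P n)) → ∀ n → P n → ∃ λ m → P m × (∀ k → P k → m ≤ k)
      least P? zero    p = zero , p , λ _ _ → z≤n
      least P? (suc n) p with P? zero
      ... | yes p₀ = zero , p₀ , λ _ _ → z≤n
      ... | no ¬p₀ with least (P? ∘ suc) n p
      ...   | m , pm , min = suc m , pm , λ { zero p₀ → ⊥-elim (¬p₀ p₀) ; (suc k) pk → s≤s (min k pk) }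

    boxicity : ∃ λ b → IsBoxicity G b
    boxicity = least boxRepresentation? order (ℕ⇒Box trivialRepresentation)

box : Graph → ℕ
box G = proj₁ (boxicity G)

box-isBoxicity : ∀ G → IsBoxicity G (box G)
box-isBoxicity G = proj₂ (boxicity G)

{-# OPTIONS --safe #-}

-- A permutation graph is the comparability graph of the intersection ≺ of two
-- linear orders L₀, L₁. Let h v be the number of ≺-predecessors of v: it is
-- strictly ≺-increasing and at most the degree of v, hence at most Δ. For an order
-- L and a level i, give v the interval
--   [0, M] if h v < i,   [L v, L v] if h v = i,   [0, L v] if h v > i,
-- where M bounds L. If u ≺ v then h u < h v and L u < L v, so their intervals meet.
-- If u and v are incomparable and i = h u ≤ h v, then L v < L u for one of the two
-- orders, and this separates them. At level Δ one order is enough, as only vertices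
-- of the same height remain to be separated; this leaves 2Δ + 1 coordinates.
module Submission where

open import Defs
open import Data.Nat using (_+_; _*_; _≤_)

open import Data.Fin using (Fin; zero; suc; toℕ; fromℕ<; splitAt; join; remQuot; combine)
open import Data.Fin.Permutation using (Permutation′; flip; _⟨$⟩ʳ_; _⟨$⟩ˡ_)
open import Data.Fin.Properties using (all?; ¬∀⟶∃¬; toℕ-injective; toℕ<n; toℕ-fromℕ<; splitAt-join; remQuot-combine)
open import Data.Integer as ℤ using (+_; -[1+_]; +[1+_]; 0ℤ; -<+; +<+)
import Data.Integer.Properties as ℤₚ
open import Data.List using (length; filter; allFin)
open import Data.List.Extrema.Nat using (xs≤max)
open import Data.List.Membership.Propositional using (_∈_)
open import Data.List.Membership.Propositional.Properties using (∈-allFin; ∈-map⁺; ∈-filter⁺; ∈-filter⁻)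
open import Data.List.Relation.Binary.Equality.Propositional using (≋⇒≡)
open import Data.List.Relation.Binary.Sublist.Propositional using (_⊆_; ⊆-refl)
open import Data.List.Relation.Binary.Sublist.Propositional.Properties using (filter⁺; length-mono-≤; to-≋)
open import Data.List.Relation.Unary.All as All using ()
open import Data.Nat using (ℕ; _<_; _∸_; _<?_; z≤n)
import Data.Nat.Properties as ℕₚ
open import Data.Product using (∃; _×_; _,_; proj₁; proj₂; uncurry; map₂; swap)
open import Data.Sum as Sum using (_⊎_; inj₁; inj₂)
open import Function using (_∘_; case_of_)
open import Function.Bundles using (_⇔_; mk⇔; module Equivalence; module Injection)
open import Function.Definitions using (Injective)
open import Function.Properties.Inverse using (↔⇒↣)
open import Relation.Binary as B using (tri<; tri≈; tri>)
open import Relation.Binary.PropositionalEquality using (_≡_; _≢_; refl; sym; trans; cong; subst)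
open import Relation.Nullary using (¬_; yes; no; contradiction)
open import Relation.Unary using (Pred; Decidable)

open Equivalence using (to; from)

-- Counting with filters, and bounds for `Δ` and `box`.

module _ {a p q} {A : Set a} {P : Pred A p} {Q : Pred A q}
         (P? : Decidable P) (Q? : Decidable Q) (P⇒Q : ∀ {x} → P x → Q x) where

  filter-mono-⊆ : ∀ xs → filter P? xs ⊆ filter Q? xs
  filter-mono-⊆ xs = filter⁺ P? Q? (λ { refl → P⇒Q }) (⊆-refl {x = xs})

  length-filter-mono-≤ : ∀ xs → length (filter P? xs) ≤ length (filter Q? xs)
  length-filter-mono-≤ xs = length-mono-≤ (filter-mono-⊆ xs)

  -- A sublist of equal length is the whole list, so equality would put `x` among the elements
  -- satisfying `P`.
  length-filter-mono-< : ∀ {x xs} → x ∈ xs → ¬ P x → Q x →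
                         length (filter P? xs) < length (filter Q? xs)
  length-filter-mono-< {x} {xs} x∈xs ¬Px Qx = ℕₚ.≤∧≢⇒< (length-filter-mono-≤ xs) λ eq →
    ¬Px (proj₂ (∈-filter⁻ P? {xs = xs}
      (subst (x ∈_) (sym (≋⇒≡ (to-≋ eq (filter-mono-⊆ xs)))) (∈-filter⁺ Q? x∈xs Qx))))

degree≤Δ : ∀ G v → Graph.degree G v ≤ Δ G
degree≤Δ G v = All.lookup (xs≤max 0 _) (∈-map⁺ (Graph.degree G) (∈-allFin v))

box≤ : ∀ {G b} → ℕ-Representation G b → box G ≤ b
box≤ {G} R = proj₂ (box-isBoxicity G) _ (ℕ⇒Box G R)

-- The intervals of a single level.

module LevelIntervals {V : Set} (height : V → ℕ) (level : ℕ) (label : V → ℕ) {M : ℕ}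
                      (label≤M : ∀ v → label v ≤ M) where

  left right : V → ℕ
  left v with ℕₚ.<-cmp (height v) level
  ... | tri< _ _ _ = 0
  ... | tri≈ _ _ _ = label v
  ... | tri> _ _ _ = 0
  right v with ℕₚ.<-cmp (height v) level
  ... | tri< _ _ _ = M
  ... | tri≈ _ _ _ = label v
  ... | tri> _ _ _ = label v

  left≤right : ∀ v → left v ≤ right v
  left≤right v with ℕₚ.<-cmp (height v) level
  ... | tri< _ _ _ = z≤n
  ... | tri≈ _ _ _ = ℕₚ.≤-refl
  ... | tri> _ _ _ = z≤n

  left≤M : ∀ v → left v ≤ M
  left≤M v with ℕₚ.<-cmp (height v) level
  ... | tri< _ _ _ = z≤n
  ... | tri≈ _ _ _ = label≤M v
  ... | tri> _ _ _ = z≤n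

  -- If `u` lies below the level, its interval is all of [0, M]; if above, both intervals contain 0.
  -- Labels matter only when `u` is exactly at the level. Keeping `lab` conditional lets it hold
  -- vacuously at level `Δ`, where labels are unrelated to the order.
  meet : ∀ {u v} → height u < height v → (height u ≡ level → label u ≤ label v) →
         left u ≤ right v × left v ≤ right u
  meet {u} {v} hu<hv lab with ℕₚ.<-cmp (height u) level
  ... | tri< _ _ _ = z≤n , left≤M v
  ... | tri≈ _ hu≡i _ with ℕₚ.<-cmp (height v) level
  ...   | tri< hv<i _ _ = contradiction (ℕₚ.<-trans hu<hv hv<i) (ℕₚ.<-irrefl hu≡i)
  ...   | tri≈ _ hv≡i _ = contradiction hu<hv (ℕₚ.<-irrefl (trans hu≡i (sym hv≡i)))
  ...   | tri> _ _ _    = lab hu≡i , z≤n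
  meet {u} {v} hu<hv lab | tri> _ _ i<hu with ℕₚ.<-cmp (height v) level
  ...   | tri< _ _ _   = z≤n , z≤n
  ...   | tri≈ _ hv≡i _ = contradiction (ℕₚ.<-trans i<hu hu<hv) (ℕₚ.<-irrefl (sym hv≡i))
  ...   | tri> _ _ _   = z≤n , z≤n

  -- At its own level `u` is the point `label u`, while `label v` is the right end of `v` both at
  -- and above the level.
  separate : ∀ {u v} → height u ≡ level → level ≤ height v → label v < label u →
             ¬ (left u ≤ right v)
  separate {u} {v} hu≡i i≤hv lv<lu with ℕₚ.<-cmp (height u) level
  ... | tri< _ hu≢i _ = contradiction hu≡i hu≢i
  ... | tri> _ hu≢i _ = contradiction hu≡i hu≢i
  ... | tri≈ _ _ _ with ℕₚ.<-cmp (height v) level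
  ...   | tri< hv<i _ _ = contradiction i≤hv (ℕₚ.<⇒≱ hv<i)
  ...   | tri≈ _ _ _ = ℕₚ.<⇒≱ lv<lu
  ...   | tri> _ _ _ = ℕₚ.<⇒≱ lv<lu

-- Comparability graphs of intersections of `d` linear orders.

_≺⟨_⟩_ : ∀ {V : Set} {d} → V → (Fin d → V → ℕ) → V → Set
u ≺⟨ L ⟩ v = ∀ k → L k u < L k v

module Comparability (G : Graph) {d M : ℕ} (L : Fin d → Graph.Vertex G → ℕ)
  (L≤M : ∀ k v → L k v ≤ M) (L-injective : ∀ k → Injective _≡_ _≡_ (L k))
  (Adj⇔ : ∀ u v → Graph.Adj G u v ⇔ (u ≺⟨ L ⟩ v ⊎ v ≺⟨ L ⟩ u)) where

  open Graph G using (Vertex; order; Adj; adj?; irrefl)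

  _≺_ : Vertex → Vertex → Set
  u ≺ v = u ≺⟨ L ⟩ v

  _≺?_ : B.Decidable _≺_
  u ≺? v = all? λ k → L k u <? L k v

  -- Obtained from the graph rather than from `<`, since for `d` = 0 the relation `≺` holds between
  -- any two vertices by definition.
  ≺-irrefl : ∀ {v} → ¬ v ≺ v
  ≺-irrefl v≺v = irrefl (from (Adj⇔ _ _) (inj₁ v≺v))

  height : Vertex → ℕ
  height v = length (filter (_≺? v) (allFin order))

  height-mono : ∀ {u v} → u ≺ v → height u < height v
  height-mono {u} {v} u≺v = length-filter-mono-< (_≺? u) (_≺? v)
    (λ w≺u k → ℕₚ.<-trans (w≺u k) (u≺v k)) (∈-allFin u) ≺-irrefl u≺v

  height≤Δ : ∀ v → height v ≤ Δ G
  height≤Δ v = ℕₚ.≤-trans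
    (length-filter-mono-≤ (_≺? v) (adj? v) (λ w≺v → from (Adj⇔ _ _) (inj₂ w≺v)) (allFin order))
    (degree≤Δ G v)

  -- Some label fails to increase strictly, and injectivity excludes equality.
  ⊀⇒> : ∀ {u v} → u ≢ v → ¬ u ≺ v → ∃ λ k → L k v < L k u
  ⊀⇒> {u} {v} u≢v u⊀v = map₂ (λ {k} Lu≮Lv → ℕₚ.≤∧≢⇒< (ℕₚ.≮⇒≥ Lu≮Lv) (u≢v ∘ sym ∘ L-injective k))
    (¬∀⟶∃¬ d _ (λ k → L k u <? L k v) u⊀v)

  -- A pair is an order with a level below `Δ`; the extra element is the only coordinate at level
  -- `Δ`.
  Coordinate : Set
  Coordinate = (Fin d × Fin (Δ G)) ⊎ Fin 1

  decode : Fin (d * Δ G + 1) → Coordinate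
  decode = Sum.map₁ (remQuot (Δ G)) ∘ splitAt (d * Δ G)

  encode : Coordinate → Fin (d * Δ G + 1)
  encode = join (d * Δ G) 1 ∘ Sum.map₁ (uncurry combine)

  -- Makes `decode` surjective, so that meeting in every numbered dimension means meeting in every
  -- `Coordinate`.
  decode-encode : ∀ c → decode (encode c) ≡ c
  decode-encode (inj₁ (k , i)) = trans (cong (Sum.map₁ (remQuot (Δ G))) (splitAt-join (d * Δ G) 1 (inj₁ (combine k i))))
    (cong inj₁ (remQuot-combine k i))
  decode-encode (inj₂ z) = cong (Sum.map₁ (remQuot (Δ G))) (splitAt-join (d * Δ G) 1 (inj₂ z))

  module Ordinary (c : Fin d × Fin (Δ G)) =
    LevelIntervals height (toℕ (proj₂ c)) (L (proj₁ c)) (L≤M (proj₁ c))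

  -- At level Δ the points may be ordered arbitrarily.
  module Top = LevelIntervals height (Δ G) toℕ (λ v → ℕₚ.<⇒≤ (toℕ<n v))

  left right : Coordinate → Vertex → ℕ
  left  (inj₁ c) = Ordinary.left c
  left  (inj₂ _) = Top.left
  right (inj₁ c) = Ordinary.right c
  right (inj₂ _) = Top.right

  left≤right : ∀ c v → left c v ≤ right c v
  left≤right (inj₁ c) = Ordinary.left≤right c
  left≤right (inj₂ _) = Top.left≤right

  Meet : Coordinate → Vertex → Vertex → Set
  Meet c u v = left c u ≤ right c v × left c v ≤ right c u

  ≺⇒Meet : ∀ {u v} → u ≺ v → ∀ c → Meet c u v
  ≺⇒Meet u≺v (inj₁ c) = Ordinary.meet c (height-mono u≺v) λ _ → ℕₚ.<⇒≤ (u≺v (proj₁ c))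
  -- A vertex of height `Δ` has nothing above it, so labels are never compared here.
  ≺⇒Meet {u} {v} u≺v (inj₂ _) = Top.meet (height-mono u≺v) λ hu≡Δ →
    contradiction (height-mono u≺v) (ℕₚ.≤⇒≯ (subst (height v ≤_) (sym hu≡Δ) (height≤Δ v)))

  Adj⇒Meet : ∀ {u v} → Adj u v → ∀ c → Meet c u v
  Adj⇒Meet {u} {v} a c with to (Adj⇔ u v) a
  ... | inj₁ u≺v = ≺⇒Meet u≺v c
  ... | inj₂ v≺u = swap (≺⇒Meet v≺u c)

  Meet⇒≺ : ∀ {u v} → u ≢ v → height u ≤ height v → (∀ c → Meet c u v) → u ≺ v
  Meet⇒≺ {u} {v} u≢v hu≤hv meets with u ≺? v
  ... | yes u≺v = u≺v
  ... | no  u⊀v with height u <? Δ G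
  -- The separating coordinate is the level of `u` itself, in an order `k` that puts `v` before `u`.
  ...   | yes hu<Δ = let k , Lv<Lu = ⊀⇒> u≢v u⊀v ; hu≡i = sym (toℕ-fromℕ< hu<Δ) ; c = k , fromℕ< hu<Δ in
          contradiction (proj₁ (meets (inj₁ c)))
            (Ordinary.separate c hu≡i (subst (_≤ height v) hu≡i hu≤hv) Lv<Lu)
  -- Now both heights equal `Δ`, so either vertex can serve as the one at the level; it is taken to
  -- be the one with the larger number.
  ...   | no hu≮Δ with ℕₚ.<-cmp (toℕ u) (toℕ v)
  ...     | tri< u<v _ _ = contradiction (proj₂ (meets (inj₂ zero))) (Top.separate hv≡Δ (ℕₚ.≮⇒≥ hu≮Δ) u<v)
    where
    hv≡Δ : height v ≡ Δ G
    hv≡Δ = ℕₚ.≤-antisym (height≤Δ v) (ℕₚ.≤-trans (ℕₚ.≮⇒≥ hu≮Δ) hu≤hv)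
  ...     | tri≈ _ u≡v _ = contradiction (toℕ-injective u≡v) u≢v
  ...     | tri> _ _ v<u = contradiction (proj₁ (meets (inj₂ zero)))
            (Top.separate (ℕₚ.≤-antisym (height≤Δ u) (ℕₚ.≮⇒≥ hu≮Δ)) (ℕₚ.≤-trans (ℕₚ.≮⇒≥ hu≮Δ) hu≤hv) v<u)

  Meet⇒Adj : ∀ {u v} → u ≢ v → (∀ c → Meet c u v) → Adj u v
  Meet⇒Adj {u} {v} u≢v meets = from (Adj⇔ u v) (case ℕₚ.≤-total (height u) (height v) of λ where
    (inj₁ hu≤hv) → inj₁ (Meet⇒≺ u≢v hu≤hv meets)
    (inj₂ hv≤hu) → inj₂ (Meet⇒≺ (u≢v ∘ sym) hv≤hu (swap ∘ meets)))

  representation : ℕ-Representation G (d * Δ G + 1)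
  representation = record
    { l    = left ∘ decode
    ; r    = right ∘ decode
    ; l≤r  = left≤right ∘ decode
    ; spec = λ u v u≢v → mk⇔ (λ a → Adj⇒Meet a ∘ decode) λ meets →
        Meet⇒Adj u≢v λ c → subst (λ c → Meet c u v) (decode-encode c) (meets (encode c))
    }

  box≤dΔ+1 : box G ≤ d * Δ G + 1
  box≤dΔ+1 = box≤ representation

-- Signs of products of integer differences.

i<j⇒i-j<0 : ∀ {i j} → i ℤ.< j → i ℤ.- j ℤ.< 0ℤ
i<j⇒i-j<0 {i} {j} i<j = subst (i ℤ.- j ℤ.<_) (ℤₚ.+-inverseʳ j) (ℤₚ.+-monoˡ-< (ℤ.- j) i<j)

j<i⇒0<i-j : ∀ {i j} → j ℤ.< i → 0ℤ ℤ.< i ℤ.- j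
j<i⇒0<i-j {i} {j} j<i = subst (ℤ._< i ℤ.- j) (ℤₚ.+-inverseʳ j) (ℤₚ.+-monoˡ-< (ℤ.- j) j<i)

i-j<0⇒i<j : ∀ {i j} → i ℤ.- j ℤ.< 0ℤ → i ℤ.< j
i-j<0⇒i<j p = ℤₚ.≤∧≢⇒< (ℤₚ.i-j≤0⇒i≤j (ℤₚ.<⇒≤ p)) λ i≡j → ℤₚ.<-irrefl (ℤₚ.i≡j⇒i-j≡0 i≡j) p

0<i-j⇒j<i : ∀ {i j} → 0ℤ ℤ.< i ℤ.- j → j ℤ.< i
0<i-j⇒j<i p = ℤₚ.≤∧≢⇒< (ℤₚ.0≤i-j⇒j≤i (ℤₚ.<⇒≤ p)) λ j≡i → ℤₚ.<-irrefl (sym (ℤₚ.i≡j⇒i-j≡0 (sym j≡i))) p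

i*j<0⇒opposite-signs : ∀ i j → i ℤ.* j ℤ.< 0ℤ → (i ℤ.< 0ℤ × 0ℤ ℤ.< j) ⊎ (0ℤ ℤ.< i × j ℤ.< 0ℤ)
i*j<0⇒opposite-signs (+ 0)    j        (+<+ ())
i*j<0⇒opposite-signs +[1+ m ] (+ 0)    p = contradiction p (ℤₚ.<-irrefl (ℤₚ.*-zeroʳ +[1+ m ]))
i*j<0⇒opposite-signs +[1+ m ] +[1+ n ] (+<+ ())
i*j<0⇒opposite-signs +[1+ m ] -[1+ n ] _ = inj₂ (ℤₚ.positive⁻¹ _ , -<+)
i*j<0⇒opposite-signs -[1+ m ] (+ 0)    p = contradiction p (ℤₚ.<-irrefl (ℤₚ.*-zeroʳ -[1+ m ]))
i*j<0⇒opposite-signs -[1+ m ] +[1+ n ] _ = inj₁ (-<+ , ℤₚ.positive⁻¹ _)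
i*j<0⇒opposite-signs -[1+ m ] -[1+ n ] (+<+ ())

opposite-signs⇒i*j<0 : ∀ {i j} → (i ℤ.< 0ℤ × 0ℤ ℤ.< j) ⊎ (0ℤ ℤ.< i × j ℤ.< 0ℤ) → i ℤ.* j ℤ.< 0ℤ
opposite-signs⇒i*j<0 { -[1+ m ]} {+[1+ n ]} (inj₁ _) = -<+
opposite-signs⇒i*j<0 {+[1+ m ]} { -[1+ n ]} (inj₂ _) = -<+
opposite-signs⇒i*j<0 {+ m}      {j}         (inj₁ (+<+ () , _))
opposite-signs⇒i*j<0 { -[1+ m ]} {+ 0}      (inj₁ (_ , +<+ ()))
opposite-signs⇒i*j<0 {+ 0}      {j}         (inj₂ (+<+ () , _))
opposite-signs⇒i*j<0 {i}        {+ n}       (inj₂ (_ , +<+ ()))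

opposite-differences : ∀ a b c d → (+ a ℤ.- + b) ℤ.* (+ c ℤ.- + d) ℤ.< 0ℤ ⇔ ((a < b × d < c) ⊎ (b < a × c < d))
opposite-differences a b c d = mk⇔
  (λ p → Sum.map (λ (x , y) → drop (i-j<0⇒i<j x) , drop (0<i-j⇒j<i y))
                 (λ (x , y) → drop (0<i-j⇒j<i x) , drop (i-j<0⇒i<j y))
                 (i*j<0⇒opposite-signs (+ a ℤ.- + b) (+ c ℤ.- + d) p))
  (λ p → opposite-signs⇒i*j<0 {+ a ℤ.- + b} {+ c ℤ.- + d}
    (Sum.map (λ (x , y) → i<j⇒i-j<0 (+<+ x) , j<i⇒0<i-j (+<+ y))
             (λ (x , y) → j<i⇒0<i-j (+<+ x) , i<j⇒i-j<0 (+<+ y)) p))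
  where
  drop : ∀ {m n} → + m ℤ.< + n → m < n
  drop = ℤₚ.drop‿+<+

-- The two linear orders of a permutation graph.

module Realizer {n} (π : Permutation′ n) where

  -- Edges are inversions, so reversing the order of positions turns them into pairs on which both
  -- orders agree. Positions are below `n`, hence the truncated subtraction loses nothing.
  L : Fin 2 → Fin n → ℕ
  L zero       v = toℕ v
  L (suc zero) v = n ∸ toℕ (π ⟨$⟩ˡ v)

  L≤n : ∀ k v → L k v ≤ n
  L≤n zero       v = ℕₚ.<⇒≤ (toℕ<n v)
  L≤n (suc zero) v = ℕₚ.m∸n≤m n (toℕ (π ⟨$⟩ˡ v))

  L-injective : ∀ k → Injective _≡_ _≡_ (L k)
  L-injective zero       = toℕ-injective
  L-injective (suc zero) =
    Injection.injective (↔⇒↣ (flip π)) ∘ toℕ-injective ∘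
    ℕₚ.∸-cancelˡ-≡ (ℕₚ.<⇒≤ (toℕ<n _)) (ℕₚ.<⇒≤ (toℕ<n _))

  ≺⇔ : ∀ u v → (toℕ u < toℕ v × toℕ (π ⟨$⟩ˡ v) < toℕ (π ⟨$⟩ˡ u)) ⇔ u ≺⟨ L ⟩ v
  ≺⇔ u v = mk⇔
    (λ { (x , y) zero → x ; (x , y) (suc zero) → ℕₚ.∸-monoʳ-< y (ℕₚ.<⇒≤ (toℕ<n _)) })
    (λ u≺v → u≺v zero , ℕₚ.∸-cancelʳ-< (u≺v (suc zero)))

  Adj⇔ : ∀ u v → Graph.Adj G[ π ] u v ⇔ (u ≺⟨ L ⟩ v ⊎ v ≺⟨ L ⟩ u)
  Adj⇔ u v = mk⇔
    (Sum.map (to (≺⇔ u v)) (to (≺⇔ v u)) ∘ to opp)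
    (from opp ∘ Sum.map (from (≺⇔ u v)) (from (≺⇔ v u)))
    where opp = opposite-differences (toℕ u) (toℕ v) (toℕ (π ⟨$⟩ˡ u)) (toℕ (π ⟨$⟩ˡ v))

theorem9 : (G : Graph) → IsPermutationGraph G → box G ≤ 2 * Δ G + 1
theorem9 G (n , π , σ , iso) = Comparability.box≤dΔ+1 G
  -- The labels are pulled back along the isomorphism, whose injectivity keeps them distinct.
  (λ k → L k ∘ (σ ⟨$⟩ʳ_))
  (λ k v → L≤n k _)
  (λ k → Injection.injective (↔⇒↣ σ) ∘ L-injective k)
  (λ u v → mk⇔ (to (Adj⇔ _ _) ∘ to (iso u v)) (from (iso u v) ∘ from (Adj⇔ _ _)))
  where open Realizer π
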